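{- Let $G=(V,E,\omega)$ be a finite directed non-negatively weighted graph, $r\in V$ a root and $k\ge 1$ an integer. Algorithm Exh-S-kSSP (described in the context), run on input $(G,r,k)$, dequeues simple paths from $r$ to any other vertex in non-decreasing order of weight: if a path $\pi$ is dequeued before a path $\pi'$, then $\omega(\pi)\le\omega(\pi')$.
   Context: $G=(V,E,\omega)$ is a finite directed graph, $E\subseteq V\times V$, with non-negative real edge weights $\omega$; $N^+(v)=\{u:(v,u)\in E\}$. A path from $s$ to $t$ is a vertex sequence $P=(s=v_1,\dots,v_\eta=t)$, $\eta\ge 1$, with $(v_i,v_{i+1})\in E$ for all $i<\eta$; $V(P)$ is its vertex set; it is simple if it has no repeated vertex; its weight is $\omega(P)=\sum_{i=1}^{\eta-1}\omega(v_i,v_{i+1})$. For a path $\Pi$ ending at $v$ and an edge $(v,u)$, $\Pi\oplus(u)$ is $\Pi$ extended by $u$. Algorithm Exh-S-kSSP. Maintain a list $T_v$ for each $v\in V$ (initially empty) and a min-priority queue $PQ$ of paths keyed by weight, initially containing only the trivial path $(r)$ with key $0$. While $PQ\ne\emptyset$: remove (dequeue) from $PQ$ a path $\Pi=(r,\dots,v)$ of minimum weight; for each $u\in N^+(v)\setminus V(\Pi)$ insert $\Pi\oplus(u)$ into $PQ$ with key $\omega(\Pi)+\omega(v,u)$; if $|T_v|<k$, add $\Pi$ to $T_v$. -}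

module Defs where

open import Data.Bool using (Bool; T; if_then_else_)
open import Data.Bool.Properties using (T?)
open import Data.Fin using (Fin; _≟_)
open import Data.List using (List; []; _∷_; _++_; _∷ʳ_; [_]; length; mapMaybe; allFin)
open import Data.List.Membership.Propositional using (_∈_)
open import Data.List.Membership.DecPropositional using (_∈?_)
open import Data.List.Relation.Unary.All using (All)
open import Data.List.Relation.Unary.Any using (_─_)
open import Data.List.Relation.Unary.Unique.Propositional using (Unique)
open import Data.Maybe using (Maybe; just; nothing)
open import Data.Nat as ℕ using (ℕ; _⊔_; _<ᵇ_)
import Data.Nat.Properties as ℕ
open import Data.Product using (∃-syntax; _,_)
open import Data.Rational as ℚ using (ℚ; 0ℚ; ½)
import Data.Rational.Properties as ℚ
import Data.Rational.Solver
open import Relation.Binary.PropositionalEquality using (_≡_; refl; sym; trans; subst)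
open import Relation.Nullary using (yes; no)

-- Real numbers: Cauchy sequences of rationals.  Equality of reals (not needed
-- below) is x ≤ y and y ≤ x.

IsCauchy : (ℕ → ℚ) → Set
IsCauchy x = ∀ ε → 0ℚ ℚ.< ε →
  ∃[ N ] (∀ m n → N ℕ.≤ m → N ℕ.≤ n → ℚ.∣ x m ℚ.- x n ∣ ℚ.< ε)

record ℝ : Set where
  field
    seq    : ℕ → ℚ
    cauchy : IsCauchy seq

open ℝ public

infix 4 _≤_

_≤_ : ℝ → ℝ → Set
x ≤ y = ∀ ε → 0ℚ ℚ.< ε →
  ∃[ N ] (∀ n → N ℕ.≤ n → seq x n ℚ.≤ seq y n ℚ.+ ε)

½-pos : ∀ {ε} → 0ℚ ℚ.< ε → 0ℚ ℚ.< ½ ℚ.* ε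
½-pos {ε} 0<ε = ℚ.positive⁻¹ _ {{ℚ.pos*pos⇒pos ½ ε {{ℚ.positive 0<ε}}}}

½+½ : ∀ ε → ½ ℚ.* ε ℚ.+ ½ ℚ.* ε ≡ ε
½+½ ε = trans (sym (ℚ.*-distribʳ-+ ε ½ ½)) (ℚ.*-identityˡ ε)

0ℝ : ℝ
0ℝ .seq _ = 0ℚ
0ℝ .cauchy ε 0<ε = 0 , λ _ _ _ _ → 0<ε

infixl 6 _+_

_+_ : ℝ → ℝ → ℝ
(x + y) .seq n = seq x n ℚ.+ seq y n
(x + y) .cauchy ε 0<ε with cauchy x _ (½-pos 0<ε) | cauchy y _ (½-pos 0<ε)
... | M , p | N , q = M ⊔ N , λ m n M⊔N≤m M⊔N≤n →
  subst (ℚ.∣ (seq x m ℚ.+ seq y m) ℚ.- (seq x n ℚ.+ seq y n) ∣ ℚ.<_) (½+½ ε)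
    (subst (λ d → ℚ.∣ d ∣ ℚ.< ½ ℚ.* ε ℚ.+ ½ ℚ.* ε)
      (interchange (seq x m) (seq x n) (seq y m) (seq y n))
      (ℚ.≤-<-trans (ℚ.∣p+q∣≤∣p∣+∣q∣ (seq x m ℚ.- seq x n) (seq y m ℚ.- seq y n))
        (ℚ.+-mono-<
          (p m n (ℕ.m⊔n≤o⇒m≤o M N M⊔N≤m) (ℕ.m⊔n≤o⇒m≤o M N M⊔N≤n))
          (q m n (ℕ.m⊔n≤o⇒n≤o M N M⊔N≤m) (ℕ.m⊔n≤o⇒n≤o M N M⊔N≤n)))))
  where
  open Data.Rational.Solver.+-*-Solver
  interchange : ∀ a b c d →
    (a ℚ.- b) ℚ.+ (c ℚ.- d) ≡ (a ℚ.+ c) ℚ.- (b ℚ.+ d)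
  interchange = solve 4 (λ a b c d →
    (a :+ (:- b)) :+ (c :+ (:- d)) := (a :+ c) :+ (:- (b :+ d))) refl

-- The vertex set is Fin n and E is the indicator function of the edge set.
record Graph : Set where
  field
    n : ℕ

  V : Set
  V = Fin n

  field
    E : V → V → Bool

  Edge : V → V → Set
  Edge v u = T (E v u)

  field
    ω   : ∀ {v u} → Edge v u → ℝ
    ω≥0 : ∀ {v u} (e : Edge v u) → 0ℝ ≤ ω e

module _ (G : Graph) where
  open Graph G

  infixl 5 _⊕_

  data Path (s : V) : V → Set where
    trivial : Path s s
    _⊕_     : ∀ {v u} → Path s v → Edge v u → Path s u

  PathFrom : V → Set
  PathFrom s = ∃[ t ] Path s t

  vertices : ∀ {s t} → Path s t → List V
  vertices {s}     trivial = [ s ]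
  vertices {t = u} (Π ⊕ _) = vertices Π ∷ʳ u

  Simple : ∀ {s t} → Path s t → Set
  Simple Π = Unique (vertices Π)

  weight : ∀ {s t} → Path s t → ℝ
  weight trivial = 0ℝ
  weight (Π ⊕ e) = weight Π + ω e

  extend : ∀ {s v} → Path s v → V → Maybe (PathFrom s)
  extend {v = v} Π u with T? (E v u) | _∈?_ _≟_ u (vertices Π)
  ... | yes e | no  _ = just (u , Π ⊕ e)
  ... | yes _ | yes _ = nothing
  ... | no  _ | _     = nothing

  -- All Π ⊕ (u) with u ∈ N⁺(v) \ V(Π).
  extensions : ∀ {s v} → Path s v → List (PathFrom s)
  extensions Π = mapMaybe (extend Π) (allFin n)

  module Exh-S-kSSP (r : V) (k : ℕ) where

    Tables : Set
    Tables = ∀ v → List (Path r v)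

    add : ∀ {v} → Path r v → Tables → Tables
    add {v} Π 𝒯 w with v ≟ w
    ... | yes refl = if length (𝒯 v) <ᵇ k then 𝒯 v ∷ʳ Π else 𝒯 v
    ... | no  _    = 𝒯 w

    -- The queue is a list whose order carries no information: any entry of
    -- minimum weight may be dequeued, so every tie-breaking rule is covered.
    record State : Set where
      constructor ⟨_,_⟩
      field
        tables : Tables
        queue  : List (PathFrom r)

    initial : State
    initial = ⟨ (λ _ → []) , [ (r , trivial) ] ⟩

    -- σ ⟶[ v , Π ] σ′: one iteration of the while loop, dequeuing Π.
    data _⟶[_]_ : State → PathFrom r → State → Set where
      iteration : ∀ {𝒯 PQ v} {Π : Path r v} (Π∈PQ : (v , Π) ∈ PQ) →
        All (λ (_ , Π′) → weight Π ≤ weight Π′) PQ →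
        ⟨ 𝒯 , PQ ⟩ ⟶[ v , Π ] ⟨ add Π 𝒯 , extensions Π ++ (PQ ─ Π∈PQ) ⟩

    -- σ ⟶*[ πs ] σ′: finitely many iterations, πs listing the dequeued paths in
    -- order of dequeuing.
    data _⟶*[_]_ : State → List (PathFrom r) → State → Set where
      stop   : ∀ {σ} → σ ⟶*[ [] ] σ
      _then_ : ∀ {σ σ′ σ″ π πs} →
        σ ⟶[ π ] σ′ → σ′ ⟶*[ πs ] σ″ → σ ⟶*[ π ∷ πs ] σ″

{-# OPTIONS --safe #-}
-- Weights are non-negative, so extending a path never lowers its weight.  When Π
-- is dequeued it is minimal in the queue; "weighs at least ω(Π)" therefore holds
-- of the whole queue, is inherited by extensions, and so holds of every path
-- dequeued later.
module Submission where

open import Defs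
open import Data.Bool.Properties using (T?)
open import Data.Fin using (_≟_)
open import Data.List using (List; []; _∷_; _∷ʳ_; allFin)
open import Data.List.Membership.DecPropositional using (_∈?_)
open import Data.List.Membership.Propositional using (_∉_)
import Data.List.Relation.Unary.All as All
open import Data.List.Relation.Unary.All using (All; []; _∷_)
import Data.List.Relation.Unary.All.Properties as All
open import Data.List.Relation.Unary.AllPairs using (AllPairs; []; _∷_)
open import Data.List.Relation.Unary.Any using (here)
open import Data.List.Relation.Unary.Unique.Propositional using (Unique)
import Data.List.Relation.Unary.Unique.Propositional.Properties as Unique
import Data.Maybe.Relation.Unary.All as Maybe
open import Data.Nat as ℕ using (ℕ; _⊔_)
import Data.Nat.Properties as ℕ
open import Data.Product using (_×_; _,_)
open import Data.Rational as ℚ using (½)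
import Data.Rational.Properties as ℚ
import Data.Rational.Solver
open import Relation.Binary.PropositionalEquality using (_≡_; refl; cong; subst; trans)
open import Relation.Nullary using (yes; no)

-- Each hypothesis is used with tolerance `½ * ε`; from index `M ⊔ N` on both bounds hold, and their
-- slacks add up to `ε`.
≤-+-nonNeg : ∀ {x y z} → x ≤ y → 0ℝ ≤ z → x ≤ y + z
≤-+-nonNeg {x} {y} {z} x≤y 0≤z ε 0<ε
  with x≤y _ (½-pos 0<ε) | 0≤z _ (½-pos 0<ε)
... | M , p | N , q = M ⊔ N , λ n M⊔N≤n →
  subst (seq x n ℚ.≤_) (regroup (seq y n) (seq z n))
    -- The left side of `q` is `0ℚ`, so adding it to `p` leaves `seq x n + 0ℚ` on the left.
    (subst (ℚ._≤ _) (ℚ.+-identityʳ (seq x n))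
      (ℚ.+-mono-≤ (p n (ℕ.m⊔n≤o⇒m≤o M N M⊔N≤n)) (q n (ℕ.m⊔n≤o⇒n≤o M N M⊔N≤n))))
  where
  open Data.Rational.Solver.+-*-Solver
  interchange : ∀ a b h → (a ℚ.+ h) ℚ.+ (b ℚ.+ h) ≡ (a ℚ.+ b) ℚ.+ (h ℚ.+ h)
  interchange = solve 3 (λ a b h → (a :+ h) :+ (b :+ h) := (a :+ b) :+ (h :+ h)) refl
  regroup : ∀ a b → (a ℚ.+ ½ ℚ.* ε) ℚ.+ (b ℚ.+ ½ ℚ.* ε) ≡ (a ℚ.+ b) ℚ.+ ε
  regroup a b = trans (interchange a b (½ ℚ.* ε)) (cong (a ℚ.+ b ℚ.+_) (½+½ ε))

Unique-∷ʳ : ∀ {A : Set} {xs : List A} {x} → Unique xs → x ∉ xs → Unique (xs ∷ʳ x)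
Unique-∷ʳ xs! x∉xs = Unique.++⁺ xs! ([] ∷ []) λ { (x∈xs , here refl) → x∉xs x∈xs }

module _ (G : Graph) where
  open Graph G

  -- The premise `u ∉ vertices G Π` mirrors the test made by `extend`; simplicity is inherited only
  -- thanks to it.
  ExtensionClosed : ∀ {s} → (PathFrom G s → Set) → Set
  ExtensionClosed {s} P = ∀ {v u} (Π : Path G s v) (e : Edge v u) →
    u ∉ vertices G Π → P (v , Π) → P (u , Π ⊕ e)

  Simple-closed : ∀ {s} → ExtensionClosed {s} (λ (_ , Π) → Simple G Π)
  Simple-closed _ _ u∉Π Π! = Unique-∷ʳ Π! u∉Π

  weight≥-closed : ∀ {s} x → ExtensionClosed {s} (λ (_ , Π) → x ≤ weight G Π)
  weight≥-closed x Π e _ x≤Π = ≤-+-nonNeg {x} {weight G Π} {ω e} x≤Π (ω≥0 e)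

  module _ {s} {P : PathFrom G s → Set} (closed : ExtensionClosed P) where

    extend-All : ∀ {v} (Π : Path G s v) → P (v , Π) → ∀ u → Maybe.All P (extend G Π u)
    -- The case split is that of `extend` itself, so `extend G Π u` reduces in each branch.
    extend-All {v} Π pΠ u with T? (E v u) | _∈?_ _≟_ u (vertices G Π)
    ... | yes e | no u∉Π = Maybe.just (closed Π e u∉Π pΠ)
    ... | yes _ | yes _  = Maybe.nothing
    ... | no  _ | _      = Maybe.nothing

    extensions-All : ∀ {v} (Π : Path G s v) → P (v , Π) → All P (extensions G Π)
    extensions-All Π pΠ =
      All.mapMaybe⁺ (All.map⁺ (All.universal (extend-All Π pΠ) (allFin n)))

  module _ (r : V) (k : ℕ) where
    open Exh-S-kSSP G r k
    open State

    -- The new queue consists of remaining old entries and extensions of `Π`, which was itself an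
    -- entry and so satisfies `P`.
    queue-All : ∀ {P : PathFrom G r → Set} {σ π σ′} → ExtensionClosed P →
      σ ⟶[ π ] σ′ → All P (queue σ) → All P (queue σ′)
    queue-All closed (iteration {Π = Π} Π∈PQ _) pPQ =
      All.++⁺ (extensions-All closed Π (All.lookup pPQ Π∈PQ)) (All.─⁺ Π∈PQ pPQ)

    -- Each path is in the queue when it is dequeued, so an invariant of the queue passes to the
    -- whole run.
    dequeued-All : ∀ {P : PathFrom G r → Set} {σ πs σ′} → ExtensionClosed P →
      σ ⟶*[ πs ] σ′ → All P (queue σ) → All P πs
    dequeued-All closed stop _ = []
    dequeued-All closed (step@(iteration Π∈PQ _) then steps) pPQ =
      All.lookup pPQ Π∈PQ ∷ dequeued-All closed steps (queue-All closed step pPQ)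

    dequeued-sorted : ∀ {σ πs σ′} → σ ⟶*[ πs ] σ′ →
      AllPairs (λ (_ , π) (_ , π′) → weight G π ≤ weight G π′) πs
    dequeued-sorted stop = []
    dequeued-sorted (step@(iteration {Π = Π} _ min) then steps) =
      -- `min` covers the queue before removal, `Π` included, so it serves as the initial instance
      -- of the invariant. The bound is chosen anew at each dequeuing.
      dequeued-All closed steps (queue-All closed step min) ∷ dequeued-sorted steps
      where
      closed : ExtensionClosed (λ (_ , Π′) → weight G Π ≤ weight G Π′)
      closed = weight≥-closed (weight G Π)

lemma2 : (G : Graph) (r : Graph.V G) (k : ℕ) → 1 ℕ.≤ k →
    let open Exh-S-kSSP G r k in
    (πs : List (PathFrom G r)) (σ : State) → initial ⟶*[ πs ] σ →
    All (λ (_ , π) → Simple G π) πs ×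
    AllPairs (λ (_ , π) (_ , π′) → weight G π ≤ weight G π′) πs
lemma2 G r k _ πs σ run =
  -- `([] ∷ []) ∷ []` says that the sole initial entry, the trivial path, is simple.
  dequeued-All G r k (Simple-closed G) run (([] ∷ []) ∷ []) , dequeued-sorted G r k run
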